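{- Let $k$ and $\ell$ be positive integers, and let $n$ be an integer with $n > \max(2k, 2\ell)$. Let $x$ and $z$ be positive real numbers such that \[ 0 < x+z < \frac{1}{k} \qquad\text{and}\qquad x+z \neq \frac{2}{n}, \] and let \[ y = \frac{x+z}{2} \qquad\text{and}\qquad w = \frac{1-k(x+z)}{n-2k}. \] Let $A$ be the $n \times n$ matrix whose $i$th row is \[ \mathrm{row}_i(A) = \begin{cases} (\underbrace{x,x,\ldots, x}_{k}, \underbrace{w,w,\ldots, w}_{n-2k}, \underbrace{z,z,\ldots, z}_{k}) & \text{if } i \in \{1,2,\ldots, \ell\},\\[2ex] (\underbrace{y,y,\ldots, y}_{k}, \underbrace{w,w,\ldots, w}_{n-2k}, \underbrace{y,y,\ldots, y}_{k}) & \text{if } i \in \{\ell+1, \ell + 2,\ldots, n -\ell\},\\[2ex] (\underbrace{z,z,\ldots, z}_{k}, \underbrace{w,w,\ldots, w}_{n-2k}, \underbrace{x,x,\ldots, x}_{k}) & \text{if } i \in \{n - \ell+1,n - \ell + 2,\ldots, n \}. \end{cases} \] Then $A$ is row stochastic but not column stochastic, and the matrix $A\,Y(A)$ obtained from $A$ after one column scaling is doubly stochastic.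
   Context: For an $n\times n$ real matrix $A = (a_{i,j})$, the $i$th row sum is $\mathrm{rowsum}_i(A) = \sum_{j=1}^n a_{i,j}$ and the $j$th column sum is $\mathrm{colsum}_j(A) = \sum_{i=1}^n a_{i,j}$. The matrix $A$ is row stochastic if all its entries are nonnegative and $\mathrm{rowsum}_i(A) = 1$ for all $i \in \{1,\ldots,n\}$; it is column stochastic if all its entries are nonnegative and $\mathrm{colsum}_j(A) = 1$ for all $j \in \{1,\ldots,n\}$; it is doubly stochastic if it is both row stochastic and column stochastic. For a nonnegative $n\times n$ matrix $A$ with all row sums and column sums positive, let $Y(A)$ be the $n\times n$ diagonal matrix \[ Y(A) = \mathrm{diag}\left( \frac{1}{\mathrm{colsum}_1(A)}, \ldots, \frac{1}{\mathrm{colsum}_n(A)} \right). \] Column scaling $A$ means replacing $A$ by $A\,Y(A)$, that is, dividing each entry of $A$ by the sum of the column containing it. -}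

module Defs where

open import Level using (_⊔_) renaming (suc to lsuc)
open import Algebra.Apartness.Bundles using (HeytingField; HeytingCommutativeRing)
open import Algebra.Bundles using (CommutativeRing; Semiring)
import Algebra.Apartness.Properties.HeytingCommutativeRing as HCRProperties
import Algebra.Definitions.RawSemiring as RawSemiringDefs
import Algebra.Properties.Ring as RingProperties
open import Data.Bool.Base using (if_then_else_)
open import Data.Fin.Base using (Fin; toℕ)
import Data.Fin.Properties as Fin
import Data.Nat.Base as ℕ
import Data.Nat.Properties as ℕₚ
open import Data.Nat.Base using (ℕ; zero; suc; NonZero; _∸_; _<ᵇ_)
open import Data.Product.Base using (_×_; _,_; proj₁; ∃-syntax)
open import Data.Sum.Base using (_⊎_; inj₁; inj₂)
open import Data.Vec.Functional using (Vector)
open import Function.Bundles using (_⇔_; Equivalence)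
open import Relation.Binary.Core using (Rel)
open import Relation.Binary.Structures using (IsStrictPartialOrder)
open import Relation.Nullary.Decidable.Core using (does)
open import Relation.Nullary.Negation.Core using (¬_)

-- The real numbers, axiomatised as a Cauchy-complete Archimedean ordered
-- field; classically these axioms determine ℝ up to unique isomorphism.
-- The order is not assumed decidable, so that constructive models of ℝ are
-- also covered: tightness of _#_ plays the role of trichotomy.

record Reals c ℓ₁ ℓ₂ ℓ₃ : Set (lsuc (c ⊔ ℓ₁ ⊔ ℓ₂ ⊔ ℓ₃)) where
  infix 4 _<_ _≤_
  infixl 7 _/ℕ_

  field
    heytingField : HeytingField c ℓ₁ ℓ₂

  open HeytingField heytingField public

  field
    _<_                  : Rel Carrier ℓ₃
    isStrictPartialOrder : IsStrictPartialOrder _≈_ _<_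
    #⇔<⊎>                : ∀ {x y} → x # y ⇔ (x < y ⊎ y < x)
    +-monoˡ-<            : ∀ {x y} z → x < y → x + z < y + z
    *-pos                : ∀ {x y} → 0# < x → 0# < y → 0# < x * y

  commutativeRing : CommutativeRing c ℓ₁
  commutativeRing = HeytingCommutativeRing.commutativeRing heytingCommutativeRing

  open RawSemiringDefs (Semiring.rawSemiring (CommutativeRing.semiring commutativeRing)) public
    using (sum) renaming (_×_ to _×ℕ_)

  fromℕ : ℕ → Carrier
  fromℕ n = n ×ℕ 1#

  _≤_ : Rel Carrier ℓ₃
  x ≤ y = ¬ (y < x)

  -- Close ε x y expresses ∣ x - y ∣ < ε.
  Close : Carrier → Rel Carrier ℓ₃
  Close ε x y = (x < y + ε) × (y < x + ε)

  Cauchy : (ℕ → Carrier) → Set (c ⊔ ℓ₃)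
  Cauchy s = ∀ ε → 0# < ε → ∃[ N ] ∀ m n → N ℕ.≤ m → N ℕ.≤ n → Close ε (s m) (s n)

  ConvergesTo : (ℕ → Carrier) → Carrier → Set (c ⊔ ℓ₃)
  ConvergesTo s l = ∀ ε → 0# < ε → ∃[ N ] ∀ n → N ℕ.≤ n → Close ε (s n) l

  field
    archimedean    : ∀ x → ∃[ n ] x < fromℕ n
    cauchyComplete : ∀ s → Cauchy s → ∃[ l ] ConvergesTo s l

  open IsStrictPartialOrder isStrictPartialOrder public
    using (<-resp-≈; <-respˡ-≈; <-respʳ-≈)
    renaming (irrefl to <-irrefl; trans to <-trans)

  private
    open RingProperties (CommutativeRing.ring commutativeRing)
      using (-‿distribˡ-*; -‿distribʳ-*; -‿involutive)

    -1*-1≈1 : (- 1#) * (- 1#) ≈ 1#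
    -1*-1≈1 = trans (sym (-‿distribˡ-* 1# (- 1#)))
             (trans (-‿cong (*-identityˡ (- 1#))) (-‿involutive 1#))

  0<1 : 0# < 1#
  0<1 with Equivalence.to #⇔<⊎> (HCRProperties.1#0 heytingCommutativeRing)
  ... | inj₂ 0<1 = 0<1
  ... | inj₁ 1<0 = <-respʳ-≈ -1*-1≈1 (*-pos 0<-1 0<-1)
    where
    0<-1 : 0# < - 1#
    0<-1 = <-respˡ-≈ (-‿inverseʳ 1#) (<-respʳ-≈ (+-identityˡ (- 1#)) (+-monoˡ-< (- 1#) 1<0))

  0<fromℕ : ∀ n → 0# < fromℕ (suc n)
  0<fromℕ zero    = <-respʳ-≈ (sym (+-identityʳ 1#)) 0<1
  0<fromℕ (suc n) = <-trans (0<fromℕ n)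
    (<-respˡ-≈ (+-identityˡ _) (+-monoˡ-< (fromℕ (suc n)) 0<1))

  0<⇒#0 : ∀ {x} → 0# < x → x # 0#
  0<⇒#0 0<x = Equivalence.from #⇔<⊎> (inj₂ 0<x)

  fromℕ#0 : ∀ n .{{_ : NonZero n}} → fromℕ n # 0#
  fromℕ#0 (suc n) = 0<⇒#0 (0<fromℕ n)

  -- #⇒invertible inverts x - 0#, which equals x.
  inverse : ∀ x → x # 0# → Carrier
  inverse x x#0 = proj₁ (#⇒invertible x#0)

  _/ℕ_ : Carrier → (n : ℕ) → .{{_ : NonZero n}} → Carrier
  x /ℕ n = x * inverse (fromℕ n) (fromℕ#0 n)

module Matrices {c ℓ₁ ℓ₂ ℓ₃} (ℝ : Reals c ℓ₁ ℓ₂ ℓ₃) where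
  open Reals ℝ

  infixl 7 _·_

  Matrix : ℕ → Set c
  Matrix n = Fin n → Fin n → Carrier

  _·_ : ∀ {n} → Matrix n → Matrix n → Matrix n
  (A · B) i j = sum λ m → A i m * B m j

  diag : ∀ {n} → Vector Carrier n → Matrix n
  diag d i j = if does (i Fin.≟ j) then d i else 0#

  rowsum : ∀ {n} → Fin n → Matrix n → Carrier
  rowsum i A = sum λ j → A i j

  colsum : ∀ {n} → Fin n → Matrix n → Carrier
  colsum j A = sum λ i → A i j

  Nonnegative : ∀ {n} → Matrix n → Set ℓ₃
  Nonnegative A = ∀ i j → 0# ≤ A i j

  record RowStochastic {n} (A : Matrix n) : Set (ℓ₁ ⊔ ℓ₃) where
    field
      nonnegative : Nonnegative A
      rowsum≈1    : ∀ i → rowsum i A ≈ 1#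

  record ColumnStochastic {n} (A : Matrix n) : Set (ℓ₁ ⊔ ℓ₃) where
    field
      nonnegative : Nonnegative A
      colsum≈1    : ∀ j → colsum j A ≈ 1#

  DoublyStochastic : ∀ {n} → Matrix n → Set (ℓ₁ ⊔ ℓ₃)
  DoublyStochastic A = RowStochastic A × ColumnStochastic A

  record Scalable {n} (A : Matrix n) : Set ℓ₃ where
    field
      nonnegative : Nonnegative A
      0<rowsum    : ∀ i → 0# < rowsum i A
      0<colsum    : ∀ j → 0# < colsum j A

  Y : ∀ {n} (A : Matrix n) → Scalable A → Matrix n
  Y A s = diag λ j → inverse (colsum j A) (0<⇒#0 (Scalable.0<colsum s j))

  -- (a, …, a, b, …, b, c, …, c) with p copies of a, n - 2p of b, p of c
  -- (intended for 2p < n).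
  bands : ∀ {a} {A : Set a} {n} (p : ℕ) (a b c : A) → Vector A n
  bands {n = n} p a b c i =
    if toℕ i <ᵇ p then a else if toℕ i <ᵇ n ∸ p then b else c

  blockMatrix : (n k ℓ : ℕ) (x y z w : Carrier) → Matrix n
  blockMatrix n k ℓ x y z w =
    bands ℓ (bands k x w z) (bands k y w y) (bands k z w x)

module _ {k ℓ n : ℕ} (2k⊔2ℓ<n : (2 ℕ.* k) ℕ.⊔ (2 ℕ.* ℓ) ℕ.< n) where

  n-nonZero : NonZero n
  n-nonZero = ℕ.>-nonZero (ℕₚ.≤-<-trans ℕ.z≤n 2k⊔2ℓ<n)

  n∸2k-nonZero : NonZero (n ∸ 2 ℕ.* k)
  n∸2k-nonZero = ℕ.>-nonZero
    (ℕₚ.m<n⇒0<n∸m (ℕₚ.≤-<-trans (ℕₚ.m≤m⊔n (2 ℕ.* k) (2 ℕ.* ℓ)) 2k⊔2ℓ<n))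

{-# OPTIONS --safe #-}
module Submission where

-- Put s = x + z, so that y + y = s.  Each row of A has the form
-- (a, …, a, w, …, w, c, …, c) with a + c = s; its sum is k s + (n - 2k) w,
-- which is 1 by the choice of w.  All entries are positive: x + z < 1/k gives
-- w > 0.  So the column sums are positive and A can be column scaled.
--
-- Call a banded vector (a, …, a, b, …, b, c, …, c), whose outer bands have the
-- same length, balanced when a + c = b + b.  The sum of a balanced vector of
-- length n is n b (sum-balanced): its entries average to the middle one.  This
-- is used in both directions.
--
-- Columns: each column of A is balanced, so colsum j A is n times the middle
-- entry of column j: n y when j is in an outer band and n w when it is in the
-- middle one (colsum≈).  If A were column stochastic, then n y = 1, hence
-- s = 2 / n, which is excluded.
--
-- Rows of the scaled matrix: dividing by the column sums turns a row of A into
-- (a/(n y), …, 1/n, …, c/(n y), …), and a + c = y + y makes this row balanced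
-- around 1/n.  So its sum is n (1/n) = 1 (sum-scaled-row).  The column sums of
-- the scaled matrix are 1 by construction.

open import Defs
open import Algebra.Bundles using (CommutativeRing)
import Algebra.Apartness.Properties.HeytingCommutativeRing as HCRProperties
import Algebra.Properties.CommutativeMonoid.Mult as CommutativeMonoidMult
import Algebra.Properties.Ring as RingProperties
import Algebra.Properties.Semiring.Mult as SemiringMult
import Algebra.Properties.Semiring.Sum as SemiringSum
open import Data.Bool.Base using (true; false; if_then_else_)
open import Data.Fin.Base using (Fin; zero; suc; toℕ; fromℕ<)
open import Data.Nat.Base as ℕ using (ℕ; NonZero; _∸_; z≤n; s≤s; _<ᵇ_)
import Data.Nat.Properties as ℕₚ
open import Data.Product.Base using (_×_; Σ-syntax; ∃-syntax; _,_; proj₂)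
open import Data.Sum.Base using (inj₁; inj₂)
open import Data.Vec.Functional using (Vector)
open import Function.Bundles using (Equivalence)
open import Relation.Binary.PropositionalEquality.Core as ≡ using (_≡_)
import Relation.Binary.Reasoning.Setoid as SetoidReasoning
open import Relation.Nullary.Negation.Core using (¬_; contradiction)

module OrderedField {c ℓ₁ ℓ₂ ℓ₃} (ℝ : Reals c ℓ₁ ℓ₂ ℓ₃) where
  open Reals ℝ
  open CommutativeRing commutativeRing using (ring; semiring)
  open HCRProperties heytingCommutativeRing using (x-0≈x)
  open RingProperties ring using (-‿distribʳ-*; x[y-z]≈xy-xz)
  open SemiringMult semiring using (×-congʳ; ×-assoc-*; ×-comm-*)
  open SetoidReasoning setoid

  -- Inverses and division by natural numbers

  inverseʳ : ∀ {u} (u#0 : u # 0#) → u * inverse u u#0 ≈ 1#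
  inverseʳ {u} u#0 = trans (*-congʳ (sym (x-0≈x u))) (proj₂ (proj₂ (#⇒invertible u#0)))

  inverse-unique : ∀ {u v v′} → u * v ≈ 1# → u * v′ ≈ 1# → v ≈ v′
  inverse-unique {u} {v} {v′} uv≈1 uv′≈1 = begin
    v            ≈⟨ *-identityʳ v ⟨
    v * 1#       ≈⟨ *-congˡ uv′≈1 ⟨
    v * (u * v′) ≈⟨ *-assoc v u v′ ⟨
    v * u * v′   ≈⟨ *-congʳ (trans (*-comm v u) uv≈1) ⟩
    1# * v′      ≈⟨ *-identityˡ v′ ⟩
    v′           ∎

  fromℕ*≈×ℕ : ∀ n u → fromℕ n * u ≈ n ×ℕ u
  fromℕ*≈×ℕ n u = trans (×-assoc-* n 1# u) (×-congʳ n (*-identityˡ u))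

  ×ℕ-/ℕ : ∀ n .{{_ : NonZero n}} u → n ×ℕ (u /ℕ n) ≈ u
  ×ℕ-/ℕ n u = begin
    n ×ℕ (u * n⁻¹)      ≈⟨ ×-comm-* n u n⁻¹ ⟨
    u * (n ×ℕ n⁻¹)      ≈⟨ *-congˡ (fromℕ*≈×ℕ n n⁻¹) ⟨
    u * (fromℕ n * n⁻¹) ≈⟨ *-congˡ (inverseʳ (fromℕ#0 n)) ⟩
    u * 1#              ≈⟨ *-identityʳ u ⟩
    u                   ∎
    where n⁻¹ = inverse (fromℕ n) (fromℕ#0 n)

  ×ℕ≈⇒≈/ℕ : ∀ n .{{_ : NonZero n}} {u v} → n ×ℕ u ≈ v → u ≈ v /ℕ n
  ×ℕ≈⇒≈/ℕ n {u} {v} nu≈v = begin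
    u                   ≈⟨ *-identityʳ u ⟨
    u * 1#              ≈⟨ *-congˡ (inverseʳ (fromℕ#0 n)) ⟨
    u * (fromℕ n * n⁻¹) ≈⟨ *-assoc u (fromℕ n) n⁻¹ ⟨
    u * fromℕ n * n⁻¹   ≈⟨ *-congʳ (trans (*-comm u (fromℕ n)) (fromℕ*≈×ℕ n u)) ⟩
    n ×ℕ u * n⁻¹        ≈⟨ *-congʳ nu≈v ⟩
    v * n⁻¹             ∎
    where n⁻¹ = inverse (fromℕ n) (fromℕ#0 n)

  half+half≈ : ∀ u → u /ℕ 2 + u /ℕ 2 ≈ u
  half+half≈ u = trans (+-congˡ (sym (+-identityʳ (u /ℕ 2)))) (×ℕ-/ℕ 2 u)

  -- Positivity

  0<⇒0≤ : ∀ {u} → 0# < u → 0# ≤ u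
  0<⇒0≤ 0<u u<0 = <-irrefl refl (<-trans 0<u u<0)

  <⇒0<- : ∀ {u v} → u < v → 0# < v - u
  <⇒0<- {u} u<v = <-respˡ-≈ (-‿inverseʳ u) (+-monoˡ-< (- u) u<v)

  inverse-pos : ∀ {u} (0<u : 0# < u) → 0# < inverse u (0<⇒#0 0<u)
  inverse-pos {u} 0<u with Equivalence.to #⇔<⊎> v#0
    where
    v = inverse u (0<⇒#0 0<u)
    vu≈1 : (v - 0#) * u ≈ 1#
    vu≈1 = trans (*-congʳ (x-0≈x v)) (trans (*-comm v u) (inverseʳ (0<⇒#0 0<u)))
    v#0 : v # 0#
    v#0 = invertible⇒# (u , trans (*-comm u (v - 0#)) vu≈1 , vu≈1)
  ... | inj₂ 0<v = 0<v
  -- A negative inverse v would give u (- v) = - 1 > 0, and so 0 > 1.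
  ... | inj₁ v<0 = contradiction (<-trans 0<1 1<0) (<-irrefl refl)
    where
    v = inverse u (0<⇒#0 0<u)
    0<-v : 0# < - v
    0<-v = <-respʳ-≈ (+-identityˡ (- v)) (<⇒0<- v<0)
    0<-1 : 0# < - 1#
    0<-1 = <-respʳ-≈ (trans (sym (-‿distribʳ-* u v)) (-‿cong (inverseʳ (0<⇒#0 0<u))))
                     (*-pos 0<u 0<-v)
    1<0 : 1# < 0#
    1<0 = <-respʳ-≈ (-‿inverseˡ 1#) (<-respˡ-≈ (+-identityˡ 1#) (+-monoˡ-< 1# 0<-1))

  ×ℕ-pos : ∀ n .{{_ : NonZero n}} {u} → 0# < u → 0# < n ×ℕ u
  ×ℕ-pos n@(ℕ.suc n-1) {u} 0<u = <-respʳ-≈ (fromℕ*≈×ℕ n u) (*-pos (0<fromℕ n-1) 0<u)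

  /ℕ-pos : ∀ n .{{_ : NonZero n}} {u} → 0# < u → 0# < u /ℕ n
  /ℕ-pos (ℕ.suc n-1) 0<u = *-pos 0<u (inverse-pos (0<fromℕ n-1))

  <1/ℕ⇒0<1-fromℕ* : ∀ n .{{_ : NonZero n}} {u} → u < 1# /ℕ n → 0# < 1# - fromℕ n * u
  <1/ℕ⇒0<1-fromℕ* n@(ℕ.suc n-1) {u} u<1/n = <-respʳ-≈ n[1/n-u]≈1-nu
    (*-pos (0<fromℕ n-1) (<⇒0<- u<1/n))
    where
    n[1/n-u]≈1-nu : fromℕ n * (1# /ℕ n - u) ≈ 1# - fromℕ n * u
    n[1/n-u]≈1-nu = begin
      fromℕ n * (1# /ℕ n - u)             ≈⟨ x[y-z]≈xy-xz (fromℕ n) (1# /ℕ n) u ⟩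
      fromℕ n * (1# /ℕ n) - fromℕ n * u   ≈⟨ +-congʳ (fromℕ*≈×ℕ n (1# /ℕ n)) ⟩
      n ×ℕ (1# /ℕ n) - fromℕ n * u        ≈⟨ +-congʳ (×ℕ-/ℕ n 1#) ⟩
      1# - fromℕ n * u                    ∎

module Banded {c ℓ₁ ℓ₂ ℓ₃} (ℝ : Reals c ℓ₁ ℓ₂ ℓ₃) where
  open Reals ℝ hiding (zero)
  open Matrices ℝ
  open OrderedField ℝ
  open CommutativeRing commutativeRing using (semiring; +-commutativeMonoid)
  open SemiringMult semiring using (×-congʳ; ×-congˡ; ×-homo-+; ×-assocˡ; ×-assoc-*)
  open SemiringSum semiring using (sum-replicate; sum-replicate-zero; sum-cong-≋; *-distribʳ-sum)
  open CommutativeMonoidMult +-commutativeMonoid using (×-distrib-+)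
  open SetoidReasoning setoid

  -- Entries of banded vectors

  bands-all : ∀ {a p} {A : Set a} {n} (P : A → Set p) m {a b c} →
    P a → P b → P c → (i : Fin n) → P (bands m a b c i)
  bands-all {n = n} P m pa pb pc i with toℕ i <ᵇ m
  ... | true = pa
  ... | false with toℕ i <ᵇ n ∸ m
  ...   | true  = pb
  ...   | false = pc

  bands-all₃ : ∀ {a r} {A : Set a} {n} (R : A → A → A → Set r) m {a b c a′ b′ c′ a″ b″ c″} →
    R a a′ a″ → R b b′ b″ → R c c′ c″ →
    (i : Fin n) → R (bands m a b c i) (bands m a′ b′ c′ i) (bands m a″ b″ c″ i)
  bands-all₃ {n = n} R m ra rb rc i with toℕ i <ᵇ m
  ... | true = ra
  ... | false with toℕ i <ᵇ n ∸ m
  ...   | true  = rb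
  ...   | false = rc

  -- With f the evaluation at j, this says that column j of a matrix made of three
  -- bands of equal rows is a banded vector.
  bands-map : ∀ {a b} {A : Set a} {B : Set b} {n} (f : A → B) m a b c (i : Fin n) →
    f (bands m a b c i) ≡ bands m (f a) (f b) (f c) i
  bands-map {n = n} f m a b c i with toℕ i <ᵇ m
  ... | true = ≡.refl
  ... | false with toℕ i <ᵇ n ∸ m
  ...   | true  = ≡.refl
  ...   | false = ≡.refl

  bands-first : ∀ {a} {A : Set a} {n} (0<n : 0 ℕ.< n) m .{{_ : NonZero m}} (a b c : A) →
    bands m a b c (fromℕ< 0<n) ≡ a
  bands-first (s≤s _) (ℕ.suc _) a b c = ≡.refl

  -- Sums of banded vectors

  -- Both cut-offs vary independently here, so that induction can lower them
  -- together with n.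
  sum-cutoffs : ∀ {p q n} a b c → p ℕ.≤ q → q ℕ.≤ n →
    sum {n} (λ i → if toℕ i <ᵇ p then a else if toℕ i <ᵇ q then b else c)
      ≈ p ×ℕ a + ((q ∸ p) ×ℕ b + (n ∸ q) ×ℕ c)
  sum-cutoffs {n = n} a b c z≤n z≤n =
    trans (sum-replicate n) (sym (trans (+-identityˡ _) (+-identityˡ _)))
  sum-cutoffs {q = ℕ.suc q} {ℕ.suc n} a b c z≤n (s≤s q≤n) = begin
    b + sum {n} (λ i → if toℕ i <ᵇ q then b else c)   ≈⟨ +-congˡ (sum-cutoffs a b c z≤n q≤n) ⟩
    b + (0# + (q ×ℕ b + (n ∸ q) ×ℕ c))                ≈⟨ +-congˡ (+-identityˡ _) ⟩
    b + (q ×ℕ b + (n ∸ q) ×ℕ c)                       ≈⟨ +-assoc _ _ _ ⟨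
    b + q ×ℕ b + (n ∸ q) ×ℕ c                         ≈⟨ +-identityˡ _ ⟨
    0# + (b + q ×ℕ b + (n ∸ q) ×ℕ c)                  ∎
  sum-cutoffs a b c (s≤s p≤q) (s≤s q≤n) =
    trans (+-congˡ (sum-cutoffs a b c p≤q q≤n)) (sym (+-assoc _ _ _))

  sum-bands : ∀ {n} p a b c → 2 ℕ.* p ℕ.≤ n →
    sum {n} (bands p a b c) ≈ p ×ℕ (a + c) + (n ∸ 2 ℕ.* p) ×ℕ b
  sum-bands {n} p a b c 2p≤n = begin
    sum {n} (bands p a b c)
      ≈⟨ sum-cutoffs a b c (ℕₚ.m+n≤o⇒m≤o∸n p p+p≤n) (ℕₚ.m∸n≤m n p) ⟩
    p ×ℕ a + ((n ∸ p ∸ p) ×ℕ b + (n ∸ (n ∸ p)) ×ℕ c)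
      ≈⟨ +-congˡ (+-cong (×-congˡ n∸p∸p≡n∸2p) (×-congˡ (ℕₚ.m∸[m∸n]≡n (ℕₚ.m+n≤o⇒m≤o p p+p≤n)))) ⟩
    p ×ℕ a + ((n ∸ 2 ℕ.* p) ×ℕ b + p ×ℕ c)   ≈⟨ +-congˡ (+-comm _ _) ⟩
    p ×ℕ a + (p ×ℕ c + (n ∸ 2 ℕ.* p) ×ℕ b)   ≈⟨ +-assoc _ _ _ ⟨
    p ×ℕ a + p ×ℕ c + (n ∸ 2 ℕ.* p) ×ℕ b     ≈⟨ +-congʳ (×-distrib-+ a c p) ⟨
    p ×ℕ (a + c) + (n ∸ 2 ℕ.* p) ×ℕ b        ∎
    where
    2p≡p+p : 2 ℕ.* p ≡ p ℕ.+ p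
    2p≡p+p = ≡.cong (p ℕ.+_) (ℕₚ.+-identityʳ p)
    p+p≤n : p ℕ.+ p ℕ.≤ n
    p+p≤n = ≡.subst (ℕ._≤ n) 2p≡p+p 2p≤n
    n∸p∸p≡n∸2p : n ∸ p ∸ p ≡ n ∸ 2 ℕ.* p
    n∸p∸p≡n∸2p = ≡.trans (ℕₚ.∸-+-assoc n p p) (≡.cong (n ∸_) (≡.sym 2p≡p+p))

  -- Opposite outer entries a and c may be replaced by b and b without changing
  -- the sum.
  sum-balanced : ∀ {n} p {a b c} → 2 ℕ.* p ℕ.≤ n → a + c ≈ b + b →
    sum {n} (bands p a b c) ≈ n ×ℕ b
  sum-balanced {n} p {a} {b} {c} 2p≤n a+c≈b+b = begin
    sum {n} (bands p a b c)                      ≈⟨ sum-bands p a b c 2p≤n ⟩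
    p ×ℕ (a + c) + (n ∸ 2 ℕ.* p) ×ℕ b            ≈⟨ +-congʳ (×-congʳ p a+c≈b+b) ⟩
    p ×ℕ (b + b) + (n ∸ 2 ℕ.* p) ×ℕ b            ≈⟨ +-congʳ (×-distrib-+ b b p) ⟩
    p ×ℕ b + p ×ℕ b + (n ∸ 2 ℕ.* p) ×ℕ b         ≈⟨ +-congʳ (+-congˡ (+-identityʳ (p ×ℕ b))) ⟨
    2 ×ℕ (p ×ℕ b) + (n ∸ 2 ℕ.* p) ×ℕ b           ≈⟨ +-congʳ (×-assocˡ b 2 p) ⟩
    (2 ℕ.* p) ×ℕ b + (n ∸ 2 ℕ.* p) ×ℕ b          ≈⟨ ×-homo-+ b (2 ℕ.* p) (n ∸ 2 ℕ.* p) ⟨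
    (2 ℕ.* p ℕ.+ (n ∸ 2 ℕ.* p)) ×ℕ b             ≈⟨ ×-congˡ (ℕₚ.m+[n∸m]≡n 2p≤n) ⟩
    n ×ℕ b                                       ∎

  -- Multiplication by a diagonal matrix

  sum-*-diag : ∀ {n} (v d : Vector Carrier n) j → sum (λ m → v m * diag d m j) ≈ v j * d j
  sum-*-diag {ℕ.suc n} v d zero = begin
    v zero * d zero + sum (λ m → v (suc m) * 0#)
      ≈⟨ +-congˡ (sum-cong-≋ (λ m → zeroʳ (v (suc m)))) ⟩
    v zero * d zero + sum {n} (λ _ → 0#)   ≈⟨ +-congˡ (sum-replicate-zero n) ⟩
    v zero * d zero + 0#                   ≈⟨ +-identityʳ _ ⟩
    v zero * d zero                        ∎
  sum-*-diag v d (suc j) = begin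
    v zero * 0# + sum (λ m → v (suc m) * diag (λ i → d (suc i)) m j)
      ≈⟨ +-cong (zeroʳ (v zero)) (sum-*-diag (λ i → v (suc i)) (λ i → d (suc i)) j) ⟩
    0# + v (suc j) * d (suc j)             ≈⟨ +-identityˡ _ ⟩
    v (suc j) * d (suc j)                  ∎

  -- One column scaling of a positive matrix

  -- Entrywise positivity.
  Positive : ∀ {n} → Matrix n → Set ℓ₃
  Positive A = ∀ i j → 0# < A i j

  module ColumnScaling {n} (A : Matrix n) (0<A : Positive A) (s : Scalable A) where

    -- The reciprocals of the column sums, that is, the diagonal of Y A s.
    d : Vector Carrier n
    d j = inverse (colsum j A) (0<⇒#0 (Scalable.0<colsum s j))

    colsum*d≈1 : ∀ j → colsum j A * d j ≈ 1#
    colsum*d≈1 j = inverseʳ (0<⇒#0 (Scalable.0<colsum s j))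

    scaled-entry : ∀ i j → (A · Y A s) i j ≈ A i j * d j
    scaled-entry i j = sum-*-diag (A i) d j

    scaled-nonnegative : Nonnegative (A · Y A s)
    scaled-nonnegative i j = 0<⇒0≤ (<-respʳ-≈ (sym (scaled-entry i j))
      (*-pos (0<A i j) (inverse-pos (Scalable.0<colsum s j))))

    scaled-columnStochastic : ColumnStochastic (A · Y A s)
    scaled-columnStochastic = record
      { nonnegative = scaled-nonnegative
      ; colsum≈1    = λ j → begin
          sum (λ i → (A · Y A s) i j)   ≈⟨ sum-cong-≋ (λ i → scaled-entry i j) ⟩
          sum (λ i → A i j * d j)       ≈⟨ *-distribʳ-sum (d j) (λ i → A i j) ⟨
          colsum j A * d j              ≈⟨ colsum*d≈1 j ⟩
          1#                            ∎
      }

    scaled-rowsum : ∀ i → rowsum i (A · Y A s) ≈ sum (λ j → A i j * d j)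
    scaled-rowsum i = sum-cong-≋ (scaled-entry i)

  -- The block matrix

  module BlockMatrix
    (k ℓ n : ℕ) .{{_ : NonZero k}} .{{_ : NonZero n}}
    (2k≤n : 2 ℕ.* k ℕ.≤ n) (2ℓ≤n : 2 ℕ.* ℓ ℕ.≤ n)
    {x y z w : Carrier}
    (0<x : 0# < x) (0<y : 0# < y) (0<z : 0# < z) (0<w : 0# < w)
    (x+z≈y+y : x + z ≈ y + y)
    where

    A : Matrix n
    A = blockMatrix n k ℓ x y z w

    -- The shape shared by all rows of A: positive outer entries a and c with
    -- a + c = 2 y, and w in the middle band.
    IsRow : Vector Carrier n → Set _
    IsRow v = ∃[ a ] ∃[ c ] v ≡ bands k a w c × 0# < a × 0# < c × a + c ≈ y + y

    row-shape : ∀ i → IsRow (A i)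
    row-shape = bands-all IsRow ℓ
      (x , z , ≡.refl , 0<x , 0<z , x+z≈y+y)
      (y , y , ≡.refl , 0<y , 0<y , refl)
      (z , x , ≡.refl , 0<z , 0<x , trans (+-comm z x) x+z≈y+y)

    positive : Positive A
    positive i j with a , c , Aᵢ≡ , 0<a , 0<c , _ ← row-shape i =
      ≡.subst (λ v → 0# < v j) (≡.sym Aᵢ≡) (bands-all (0# <_) k 0<a 0<w 0<c j)

    rowsum≈ : ∀ i → rowsum i A ≈ k ×ℕ (y + y) + (n ∸ 2 ℕ.* k) ×ℕ w
    rowsum≈ i with a , c , Aᵢ≡ , _ , _ , a+c≈y+y ← row-shape i = begin
      sum (A i)                                 ≡⟨ ≡.cong sum Aᵢ≡ ⟩
      sum {n} (bands k a w c)                   ≈⟨ sum-bands k a w c 2k≤n ⟩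
      k ×ℕ (a + c) + (n ∸ 2 ℕ.* k) ×ℕ w         ≈⟨ +-congʳ (×-congʳ k a+c≈y+y) ⟩
      k ×ℕ (y + y) + (n ∸ 2 ℕ.* k) ×ℕ w         ∎

    -- The row (y, …, y, w, …, w, y, …, y), which fills the middle band of rows.
    middleRow : Vector Carrier n
    middleRow = bands k y w y

    middleRow-pos : ∀ j → 0# < middleRow j
    middleRow-pos = bands-all (0# <_) k 0<y 0<w 0<y

    colsum≈ : ∀ j → colsum j A ≈ n ×ℕ middleRow j
    colsum≈ j = begin
      sum (λ i → A i j)
        ≈⟨ sum-cong-≋ {n} (λ i → reflexive (bands-map (λ v → v j) ℓ top middleRow bottom i)) ⟩
      sum {n} (bands ℓ (top j) (middleRow j) (bottom j))
        ≈⟨ sum-balanced ℓ 2ℓ≤n top+bottom≈ ⟩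
      n ×ℕ middleRow j ∎
      where
      top bottom : Vector Carrier n
      top    = bands k x w z
      bottom = bands k z w x
      top+bottom≈ : top j + bottom j ≈ middleRow j + middleRow j
      top+bottom≈ = bands-all₃ (λ t m b → t + b ≈ m + m) k
        x+z≈y+y refl (trans (+-comm z x) x+z≈y+y) j

    0<colsum : ∀ j → 0# < colsum j A
    0<colsum j = <-respʳ-≈ (sym (colsum≈ j)) (×ℕ-pos n (middleRow-pos j))

    columnStochastic⇒ : ColumnStochastic A → n ×ℕ y ≈ 1#
    columnStochastic⇒ cs = begin
      n ×ℕ y                ≡⟨ ≡.cong (n ×ℕ_) (bands-first 0<n k y w y) ⟨
      n ×ℕ middleRow j₀     ≈⟨ colsum≈ j₀ ⟨
      colsum j₀ A           ≈⟨ ColumnStochastic.colsum≈1 cs j₀ ⟩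
      1#                    ∎
      where
      0<n : 0 ℕ.< n
      0<n = ℕ.>-nonZero⁻¹ n
      -- The first column lies in an outer band because k is positive.
      j₀ : Fin n
      j₀ = fromℕ< 0<n

    -- The only property of d that matters is that d j is the reciprocal of
    -- n times the j-th entry of middleRow.
    sum-scaled-row : (d : Vector Carrier n) → (∀ j → (n ×ℕ middleRow j) * d j ≈ 1#) →
      ∀ i → sum (λ j → A i j * d j) ≈ 1#
    sum-scaled-row d md≈1 i with a , c , Aᵢ≡ , _ , _ , a+c≈y+y ← row-shape i = begin
      sum (λ j → A i j * d j)
        ≈⟨ sum-cong-≋ {n} (λ j → trans (reflexive (≡.cong (λ v → v j * d j) Aᵢ≡)) (entry j)) ⟩
      sum {n} (bands k (a * r) 1/n (c * r))   ≈⟨ sum-balanced k 2k≤n balanced ⟩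
      n ×ℕ 1/n                                ≈⟨ ×ℕ-/ℕ n 1# ⟩
      1#                                      ∎
      where
      1/n = 1# /ℕ n
      0<ny = ×ℕ-pos n 0<y

      r : Carrier
      r = inverse (n ×ℕ y) (0<⇒#0 0<ny)

      ny*r≈1 : (n ×ℕ y) * r ≈ 1#
      ny*r≈1 = inverseʳ (0<⇒#0 0<ny)

      *≈1/n : ∀ {u t} → (n ×ℕ u) * t ≈ 1# → u * t ≈ 1/n
      *≈1/n {u} {t} nu*t≈1 = ×ℕ≈⇒≈/ℕ n (trans (sym (×-assoc-* n u t)) nu*t≈1)

      -- The relation is stated for every scaling factor t because d j varies
      -- with j, while the three bands are treated once each.
      entry : ∀ j → bands k a w c j * d j ≈ bands k (a * r) 1/n (c * r) j
      entry j = bands-all₃ (λ u m v → ∀ {t} → (n ×ℕ m) * t ≈ 1# → u * t ≈ v) k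
        (λ ny*t≈1 → *-congˡ (inverse-unique ny*t≈1 ny*r≈1))
        *≈1/n
        (λ ny*t≈1 → *-congˡ (inverse-unique ny*t≈1 ny*r≈1))
        j (md≈1 j)

      balanced : a * r + c * r ≈ 1/n + 1/n
      balanced = begin
        a * r + c * r   ≈⟨ distribʳ r a c ⟨
        (a + c) * r     ≈⟨ *-congʳ a+c≈y+y ⟩
        (y + y) * r     ≈⟨ distribʳ r y y ⟩
        y * r + y * r   ≈⟨ +-cong (*≈1/n ny*r≈1) (*≈1/n ny*r≈1) ⟩
        1/n + 1/n       ∎

theorem1 : ∀ {c ℓ₁ ℓ₂ ℓ₃} (ℝ : Reals c ℓ₁ ℓ₂ ℓ₃) →
    let open Reals ℝ
        open Matrices ℝ
    in
    (k ℓ n : ℕ) .{{_ : NonZero k}} .{{_ : NonZero ℓ}}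
    (2k⊔2ℓ<n : (2 ℕ.* k) ℕ.⊔ (2 ℕ.* ℓ) ℕ.< n)
    (x z : Carrier) → 0# < x → 0# < z →
    0# < x + z → x + z < 1# /ℕ k →
    ¬ (x + z ≈ _/ℕ_ (fromℕ 2) n {{n-nonZero {k} {ℓ} 2k⊔2ℓ<n}}) →
    let y = (x + z) /ℕ 2
        w = _/ℕ_ (1# - fromℕ k * (x + z)) (n ∸ 2 ℕ.* k) {{n∸2k-nonZero {k} {ℓ} 2k⊔2ℓ<n}}
        A = blockMatrix n k ℓ x y z w
    in
    RowStochastic A × ¬ ColumnStochastic A × (Σ[ s ∈ Scalable A ] DoublyStochastic (A · Y A s))
theorem1 ℝ k ℓ n 2k⊔2ℓ<n x z 0<x 0<z 0<x+z x+z<1/k x+z≉2/n =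
  rowStochastic , ¬columnStochastic , scalable ,
  record { nonnegative = scaled-nonnegative ; rowsum≈1 = scaled-rowsum≈1 } ,
  scaled-columnStochastic
  where
  open Reals ℝ
  open Matrices ℝ
  open OrderedField ℝ
  open CommutativeRing commutativeRing using (semiring; +-commutativeMonoid)
  open SemiringMult semiring using (×-congʳ)
  open CommutativeMonoidMult +-commutativeMonoid using (×-distrib-+)
  open SetoidReasoning setoid

  instance
    n≢0 : NonZero n
    n≢0 = n-nonZero {k} {ℓ} 2k⊔2ℓ<n
    n∸2k≢0 : NonZero (n ∸ 2 ℕ.* k)
    n∸2k≢0 = n∸2k-nonZero {k} {ℓ} 2k⊔2ℓ<n

  2k≤n : 2 ℕ.* k ℕ.≤ n
  2k≤n = ℕₚ.≤-trans (ℕₚ.m≤m⊔n (2 ℕ.* k) (2 ℕ.* ℓ)) (ℕₚ.<⇒≤ 2k⊔2ℓ<n)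

  2ℓ≤n : 2 ℕ.* ℓ ℕ.≤ n
  2ℓ≤n = ℕₚ.≤-trans (ℕₚ.m≤n⊔m (2 ℕ.* k) (2 ℕ.* ℓ)) (ℕₚ.<⇒≤ 2k⊔2ℓ<n)

  y w : Carrier
  y = (x + z) /ℕ 2
  w = (1# - fromℕ k * (x + z)) /ℕ (n ∸ 2 ℕ.* k)

  y+y≈x+z : y + y ≈ x + z
  y+y≈x+z = half+half≈ (x + z)

  open Banded ℝ
  open BlockMatrix k ℓ n 2k≤n 2ℓ≤n 0<x (/ℕ-pos 2 0<x+z) 0<z
    (/ℕ-pos (n ∸ 2 ℕ.* k) (<1/ℕ⇒0<1-fromℕ* k x+z<1/k)) (sym y+y≈x+z)

  rowsum≈1 : ∀ i → rowsum i A ≈ 1#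
  rowsum≈1 i = begin
    rowsum i A                                ≈⟨ rowsum≈ i ⟩
    k ×ℕ (y + y) + (n ∸ 2 ℕ.* k) ×ℕ w         ≈⟨ +-congˡ (×ℕ-/ℕ (n ∸ 2 ℕ.* k) _) ⟩
    k ×ℕ (y + y) + (1# - fromℕ k * (x + z))   ≈⟨ +-congʳ (×-congʳ k y+y≈x+z) ⟩
    k ×ℕ (x + z) + (1# - fromℕ k * (x + z))   ≈⟨ +-congʳ (fromℕ*≈×ℕ k (x + z)) ⟨
    ks + (1# - ks)                            ≈⟨ +-comm _ _ ⟩
    1# - ks + ks                              ≈⟨ +-assoc _ _ _ ⟩
    1# + (- ks + ks)                          ≈⟨ +-congˡ (-‿inverseˡ ks) ⟩
    1# + 0#                                   ≈⟨ +-identityʳ 1# ⟩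
    1#                                        ∎
    where ks = fromℕ k * (x + z)

  rowStochastic : RowStochastic A
  rowStochastic = record
    { nonnegative = λ i j → 0<⇒0≤ (positive i j)
    ; rowsum≈1    = rowsum≈1
    }

  ¬columnStochastic : ¬ ColumnStochastic A
  ¬columnStochastic cs = x+z≉2/n (×ℕ≈⇒≈/ℕ n (begin
    n ×ℕ (x + z)       ≈⟨ ×-congʳ n y+y≈x+z ⟨
    n ×ℕ (y + y)       ≈⟨ ×-distrib-+ y y n ⟩
    n ×ℕ y + n ×ℕ y    ≈⟨ +-cong (columnStochastic⇒ cs) (columnStochastic⇒ cs) ⟩
    1# + 1#            ≈⟨ +-congˡ (+-identityʳ 1#) ⟨
    fromℕ 2            ∎))

  scalable : Scalable A
  scalable = record
    { nonnegative = λ i j → 0<⇒0≤ (positive i j)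
    ; 0<rowsum    = λ i → <-respʳ-≈ (sym (rowsum≈1 i)) 0<1
    ; 0<colsum    = 0<colsum
    }

  open ColumnScaling A positive scalable

  scaled-rowsum≈1 : ∀ i → rowsum i (A · Y A scalable) ≈ 1#
  scaled-rowsum≈1 i = trans (scaled-rowsum i)
    (sum-scaled-row d (λ j → trans (*-congʳ (sym (colsum≈ j))) (colsum*d≈1 j)) i)
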